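{- Let $p,t$ be positive integers, let $n_1,\dots,n_p$ be positive integers, let $X=[n]$ with $n=n_1+\cdots+n_p$, partitioned into consecutive blocks $X_1=[n_1]$ and $X_i=\left[\sum_{j\le i}n_j\right]\setminus\left[\sum_{j\le i-1}n_j\right]$ for $i=2,\dots,p$. Let $\mathcal{R}\subset(\mathbb{Z}^+)^p$ be a non-empty finite set and put $$\mathcal{H}_2=\bigcup_{(r_1,\dots,r_p)\in\mathcal{R}}\left\{F\subset X:|F\cap X_i|=r_i,\ i=1,\dots,p\right\}.$$ Let $b$ and $c$ denote respectively the maximum and the minimum of all numbers appearing as coordinates of elements of $\mathcal{R}$. Suppose $t\le c$ and $n_i>2(t+1)pb^{t+2}$ for every $i\in[p]$. Then every $t$-intersecting subfamily $\mathcal{F}\subset\mathcal{H}_2$ of maximum size is trivial, i.e. there is a $t$-subset $T\subset X$ contained in every member of $\mathcal{F}$.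
   Context: A family $\mathcal{F}$ is $t$-intersecting if $|A\cap B|\ge t$ for all $A,B\in\mathcal{F}$. $[m]=\{1,\dots,m\}$. -}

module Defs where

open import Data.Nat using (ℕ; zero; suc; _+_; _*_; _^_; _≤_; _<_; _≤ᵇ_; _<ᵇ_)
open import Data.Bool using (Bool; _∧_)
open import Data.Fin using (Fin; zero; suc; toℕ)
open import Data.Fin.Subset using (Subset; _∩_; ∣_∣; _⊆_)
open import Data.Vec using (tabulate)
open import Data.List using (List)
open import Data.List.Membership.Propositional using () renaming (_∈_ to _∈ₗ_)
open import Data.Product using (Σ; _×_; ∃)
open import Function using (_∘_)

total : (p : ℕ) → (Fin p → ℕ) → ℕ
total zero    ns = 0
total (suc p) ns = ns zero + total p (ns ∘ suc)

lower : ∀ {p} → (Fin p → ℕ) → Fin p → ℕ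
lower ns zero    = 0
lower ns (suc i) = ns zero + lower (ns ∘ suc) i

-- The ground set X = [n] is modelled as Fin n (element k ↔ k+1).
-- Block X_i = { x : lower i ≤ x < lower i + n_i } (consecutive blocks).
block : ∀ {p} (ns : Fin p → ℕ) → Fin p → Subset (total p ns)
block ns i = tabulate (λ x → (lower ns i ≤ᵇ toℕ x) ∧ (toℕ x <ᵇ lower ns i + ns i))

hasProfile : ∀ {p} (ns : Fin p → ℕ) → Subset (total p ns) → (Fin p → ℕ) → Set
hasProfile ns F r = ∀ i → ∣ F ∩ block ns i ∣ ≡ r i
  where open import Relation.Binary.PropositionalEquality using (_≡_)

inH2 : ∀ {p} (ns : Fin p → ℕ) → List (Fin p → ℕ) → Subset (total p ns) → Set
inH2 ns R F = Σ (Fin _ → ℕ) λ r → (r ∈ₗ R) × hasProfile ns F r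

-- t-intersecting family (families are duplicate-free lists of subsets)
tIntersecting : ∀ {n} → ℕ → List (Subset n) → Set
tIntersecting t 𝓕 = ∀ {A B} → A ∈ₗ 𝓕 → B ∈ₗ 𝓕 → t ≤ ∣ A ∩ B ∣

trivial : ∀ {n} → ℕ → List (Subset n) → Set
trivial {n} t 𝓕 = Σ (Subset n) λ T → (∣ T ∣ ≡ t) × (∀ {A} → A ∈ₗ 𝓕 → T ⊆ A)
  where open import Relation.Binary.PropositionalEquality using (_≡_)

{-# OPTIONS --safe #-}

-- Let B be a smallest set of size at least t that meets every member of 𝓕 in at least t points; if |B| = t,
-- then 𝓕 is trivial. Suppose |B| = t + j with j ≥ 1. Every member of 𝓕 contains a t-subset of B, reached by
-- deleting j points with t + 1 choices each. By minimality of B, no set of size from t to t + j - 1 meets all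
-- of 𝓕 in t points, so a set contained in a member can be enlarged within it, with at most pb choices each
-- time, up to size t + j. Adding a point to S divides the number of members of H₂ containing S by at least
-- n_i / b, and for |S| ≥ t that number is at most |𝓕| because these members form a t-intersecting family.
-- Writing N for a lower bound on the n_i, this yields N^j |𝓕| ≤ ((t + 1) p b²)^j |𝓕|, which is absurd as
-- N > (t + 1) p b².

module Submission where

open import Defs
open import Data.Nat using (ℕ; suc; _+_; _*_; _^_; _≤_; _<_)
open import Data.Fin using (Fin)
open import Data.Fin.Subset using (Subset)
open import Data.List using (List; []; length)
open import Data.List.Membership.Propositional using (_∈_)
open import Data.List.Relation.Unary.Unique.Propositional using (Unique)
open import Data.Product using (Σ; _×_)
open import Relation.Binary.PropositionalEquality using (_≡_; _≢_)

open import Data.Bool using (true; false; if_then_else_; _∧_)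
open import Data.Bool.Properties using (T-≡; T-∧)
open import Data.Fin using (zero; suc; toℕ)
open import Data.Fin.Permutation.Components using (transpose; transpose-inverse)
open import Data.Fin.Properties using (toℕ<n; suc-injective; all?; any?) renaming (_≟_ to _≟ᶠ_)
open import Data.Fin.Subset using (inside; outside; ⊤; ∣_∣; _⊆_; _∩_; _∪_; _─_; _-_; ⁅_⁆)
  renaming (_∈_ to _∈ₛ_; _∉_ to _∉ₛ_)
open import Data.Fin.Subset.Properties using
  (_∈?_; _⊆?_; nonempty?; anySubset?; p⊆q⇒∣p∣≤∣q∣; p⊂q⇒∣p∣<∣q∣; ∣⊤∣≡n; ∈⊤; Empty-unique; ∣⊥∣≡0;
   x∈⁅x⁆; x∈⁅y⁆⇒x≡y; x∈p∩q⁺; x∈p∩q⁻; p∩q⊆p; ∣p∩q∣≤∣p∣; p⊆p∪q; q⊆p∪q; x∈p∪q⁻; p─q⊆p; ∪-identityʳ;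
   x∈p∧x∉q⇒x∈p─q; p─q─q≡p─q; x∈p∧x≢y⇒x∈p-y; x∈p⇒∣p-x∣<∣p∣; p∩q≢∅⇒∣p─q∣<∣p∣)
open import Data.List using (_∷_; map; filter; _++_; take; allFin)
import Data.List.Relation.Unary.Any as Any
open import Data.List.Membership.Propositional using (find; lose)
open import Data.List.Membership.Propositional.Properties using
  (∈-∃++; ∈-++⁻; ∈-++⁺ˡ; ∈-++⁺ʳ; ∈-map⁺; ∈-map⁻; ∈-filter⁺; ∈-filter⁻; ∈-allFin; ∈-length)
open import Data.List.Properties using (length-map; length-++; length-take; length-tabulate; filter-all)
open import Data.List.Relation.Unary.All as All using (All; []; _∷_)
import Data.List.Relation.Unary.All.Properties as All
open import Data.List.Relation.Unary.Any using (here; there)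
open import Data.List.Relation.Unary.AllPairs using ([]; _∷_)
import Data.List.Relation.Unary.Unique.Propositional.Properties as Unique
open import Data.Nat using (zero; z≤n; s≤s; s≤s⁻¹; _∸_; _≤?_; _<?_; _≟_; _≤ᵇ_; _<ᵇ_;
  >-nonZero)
open import Data.Nat.Induction using (<-rec)
open import Data.Nat.ListAction using (sum)
open import Data.Nat.Properties hiding (_≟_; _≤?_; _<?_; suc-injective)
open import Data.Nat.Tactic.RingSolver using (solve-∀)
open import Data.Product using (∃; _,_; proj₁; proj₂; uncurry)
open import Data.Sum using (_⊎_; inj₁; inj₂; [_,_]′)
open import Data.Vec using ([]; _∷_; here; there; lookup; tabulate)
open import Data.Vec.Properties using
  ([]=⇒lookup; lookup⇒[]=; lookup∘tabulate; tabulate∘lookup; tabulate-cong; ∷-injectiveʳ)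
open import Function using (_∘_; id; case_of_)
open import Function.Bundles using (Equivalence)
open import Relation.Binary.PropositionalEquality using (refl; sym; trans; cong; cong₂; subst; module ≡-Reasoning)
open import Relation.Nullary using (¬_; Dec; yes; no; does; contradiction; _×-dec_; ¬?)
import Relation.Nullary.Decidable as Dec
open import Relation.Unary using (Decidable)

^-distribʳ-* : ∀ m n o → (m * n) ^ o ≡ m ^ o * n ^ o
^-distribʳ-* m n zero    = refl
^-distribʳ-* m n (suc o) rewrite ^-distribʳ-* m n o = *-interchange m n (m ^ o) (n ^ o)
  where
  *-interchange : ∀ a b c d → a * b * (c * d) ≡ a * c * (b * d)
  *-interchange = solve-∀

-- Counting in lists

module _ {A : Set} where

  count : {P : A → Set} → Decidable P → List A → ℕ
  count P? xs = length (filter P? xs)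

  ∑ : List A → (A → ℕ) → ℕ
  ∑ xs f = sum (map f xs)

  length≡suc⇒∃∈ : ∀ {m} (xs : List A) → length xs ≡ suc m → ∃ λ x → x ∈ xs
  length≡suc⇒∃∈ (x ∷ _) _ = x , here refl

  count-∷ : {P : A → Set} (P? : Decidable P) (x : A) (xs : List A) →
            count P? (x ∷ xs) ≡ (if does (P? x) then 1 else 0) + count P? xs
  count-∷ P? x xs with does (P? x)
  ... | true  = refl
  ... | false = refl

  ∑-zero : (xs : List A) → ∑ xs (λ _ → 0) ≡ 0
  ∑-zero []       = refl
  ∑-zero (x ∷ xs) = ∑-zero xs

  ∑-cong : {f g : A → ℕ} → (∀ x → f x ≡ g x) → (xs : List A) → ∑ xs f ≡ ∑ xs g
  ∑-cong f≡g []       = refl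
  ∑-cong f≡g (x ∷ xs) = cong₂ _+_ (f≡g x) (∑-cong f≡g xs)

  ∑-count-∷ : {P : A → Set} (P? : Decidable P) (f : A → ℕ) (xs : List A) →
              ∑ xs (λ x → (if does (P? x) then 1 else 0) + f x) ≡ count P? xs + ∑ xs f
  ∑-count-∷ P? f []       = refl
  ∑-count-∷ P? f (x ∷ xs) rewrite count-∷ P? x xs | ∑-count-∷ P? f xs =
    +-interchange (if does (P? x) then 1 else 0) (f x) (count P? xs) (∑ xs f)
    where
    +-interchange : ∀ a b c d → a + b + (c + d) ≡ a + c + (b + d)
    +-interchange = solve-∀

  ∑-mono : {f : A → ℕ} {w m : ℕ} (xs : List A) → (∀ {x} → x ∈ xs → f x * w ≤ m) → ∑ xs f * w ≤ length xs * m
  ∑-mono                 []       f≤ = z≤n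
  ∑-mono {f} {w} {m} (x ∷ xs) f≤ = begin
    (f x + ∑ xs f) * w      ≡⟨ *-distribʳ-+ w (f x) (∑ xs f) ⟩
    f x * w + ∑ xs f * w    ≤⟨ +-mono-≤ (f≤ (here refl)) (∑-mono xs (f≤ ∘ there)) ⟩
    m + length xs * m       ∎
    where open ≤-Reasoning

  ∑-mono-lower : {f : A → ℕ} {m : ℕ} (xs : List A) → (∀ {x} → x ∈ xs → m ≤ f x) → length xs * m ≤ ∑ xs f
  ∑-mono-lower []       m≤ = z≤n
  ∑-mono-lower (x ∷ xs) m≤ = +-mono-≤ (m≤ (here refl)) (∑-mono-lower xs (m≤ ∘ there))

  count-mono : {P Q : A → Set} (P? : Decidable P) (Q? : Decidable Q) (xs : List A) →
               (∀ {x} → x ∈ xs → P x → Q x) → count P? xs ≤ count Q? xs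
  count-mono P? Q? []       P⇒Q = z≤n
  count-mono P? Q? (x ∷ xs) P⇒Q with ih ← count-mono P? Q? xs (P⇒Q ∘ there) | P? x | Q? x
  ... | yes px | yes qx = s≤s ih
  ... | yes px | no ¬qx = contradiction (P⇒Q (here refl) px) ¬qx
  ... | no ¬px | yes qx = m≤n⇒m≤1+n ih
  ... | no ¬px | no ¬qx = ih

module _ {A B : Set} where

  -- Both sides count the pairs with `Q y x`. In the induction on `xs`, a new `x` adds one to the
  -- term of exactly those `y` that are related to it.
  double-count : {Q : B → A → Set} (Q? : ∀ y → Decidable (Q y)) (xs : List A) (ys : List B) →
                 ∑ ys (λ y → count (Q? y) xs) ≡ ∑ xs (λ x → count (λ y → Q? y x) ys)
  double-count Q? []       ys = ∑-zero ys
  double-count Q? (x ∷ xs) ys = begin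
    ∑ ys (λ y → count (Q? y) (x ∷ xs))
      ≡⟨ ∑-cong (λ y → count-∷ (Q? y) x xs) ys ⟩
    ∑ ys (λ y → (if does (Q? y x) then 1 else 0) + count (Q? y) xs)
      ≡⟨ ∑-count-∷ (λ y → Q? y x) (λ y → count (Q? y) xs) ys ⟩
    count (λ y → Q? y x) ys + ∑ ys (λ y → count (Q? y) xs)
      ≡⟨ cong (count (λ y → Q? y x) ys +_) (double-count Q? xs ys) ⟩
    count (λ y → Q? y x) ys + ∑ xs (λ x → count (λ y → Q? y x) ys) ∎
    where open ≡-Reasoning

  length≤∑-cover : {Q : B → A → Set} (Q? : ∀ y → Decidable (Q y)) (xs : List A) (ys : List B) →
                   (∀ {x} → x ∈ xs → ∃ λ y → y ∈ ys × Q y x) → length xs ≤ ∑ ys (λ y → count (Q? y) xs)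
  length≤∑-cover Q? xs ys cover = begin
    length xs                             ≡⟨ *-identityʳ (length xs) ⟨
    length xs * 1                         ≤⟨ ∑-mono-lower xs covered ⟩
    ∑ xs (λ x → count (λ y → Q? y x) ys)  ≡⟨ double-count Q? xs ys ⟨
    ∑ ys (λ y → count (Q? y) xs)          ∎
    where
    open ≤-Reasoning
    covered : ∀ {x} → x ∈ xs → 1 ≤ count (λ y → Q? y x) ys
    covered {x} x∈xs with y , y∈ys , q ← cover x∈xs = ∈-length (∈-filter⁺ (λ y → Q? y x) y∈ys q)

  -- A union bound: every `x` with `P x` is counted by some `Q y`. The weight `w` stays on the left
  -- so that later bounds, where it is a power of `N`, need no division.
  count≤-cover : {P : A → Set} {Q : B → A → Set} (P? : Decidable P) (Q? : ∀ y → Decidable (Q y))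
                 (xs : List A) (ys : List B) {w m : ℕ} →
                 (∀ {x} → x ∈ xs → P x → ∃ λ y → y ∈ ys × Q y x) →
                 (∀ {y} → y ∈ ys → count (Q? y) xs * w ≤ m) →
                 count P? xs * w ≤ length ys * m
  count≤-cover P? Q? xs ys {w} {m} cover bound = begin
    count P? xs * w                              ≤⟨ *-monoˡ-≤ w (length≤∑-cover Q? _ ys cover′) ⟩
    ∑ ys (λ y → count (Q? y) (filter P? xs)) * w ≤⟨ ∑-mono ys bound′ ⟩
    length ys * m                                ∎
    where
    open ≤-Reasoning
    cover′ : ∀ {x} → x ∈ filter P? xs → ∃ λ y → y ∈ ys × _
    cover′ x∈ = uncurry cover (∈-filter⁻ P? x∈)
    filter-filter : ∀ {R : A → Set} (R? : Decidable R) zs → count R? (filter P? zs) ≤ count R? zs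
    filter-filter R? []       = z≤n
    filter-filter R? (z ∷ zs) with does (P? z)
    ... | true rewrite count-∷ R? z (filter P? zs) | count-∷ R? z zs =
      +-monoʳ-≤ (if does (R? z) then 1 else 0) (filter-filter R? zs)
    ... | false rewrite count-∷ R? z zs = ≤-trans (filter-filter R? zs) (m≤n+m _ (if does (R? z) then 1 else 0))
    bound′ : ∀ {y} → y ∈ ys → count (Q? y) (filter P? xs) * w ≤ m
    bound′ {y} y∈ys = ≤-trans (*-monoˡ-≤ w (filter-filter (Q? y) xs)) (bound y∈ys)

  -- Cut the image of the head out of `ys`. By injectivity and uniqueness no other image is the
  -- entry cut out, so the tail still maps into the rest.
  injection⇒length≤ : (f : A → B) → (∀ {x y} → f x ≡ f y → x ≡ y) → {xs : List A} → Unique xs →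
                      (ys : List B) → (∀ {x} → x ∈ xs → f x ∈ ys) → length xs ≤ length ys
  injection⇒length≤ f inj []              ys into = z≤n
  injection⇒length≤ f inj (x∉xs ∷ unique) ys into with ∈-∃++ (into (here refl))
  ... | as , bs , refl = begin
    suc _                       ≤⟨ s≤s (injection⇒length≤ f inj unique (as ++ bs) into′) ⟩
    suc (length (as ++ bs))     ≡⟨ cong suc (length-++ as) ⟩
    suc (length as + length bs) ≡⟨ +-suc (length as) (length bs) ⟨
    length as + suc (length bs) ≡⟨ length-++ as ⟨
    length (as ++ _ ∷ bs)       ∎
    where
    open ≤-Reasoning
    into′ : ∀ {y} → y ∈ _ → f y ∈ as ++ bs
    into′ y∈ with ∈-++⁻ as (into (there y∈))
    ... | inj₁ fy∈as         = ∈-++⁺ˡ fy∈as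
    ... | inj₂ (here fy≡fx)  = contradiction (sym (inj fy≡fx)) (All.lookup x∉xs y∈)
    ... | inj₂ (there fy∈bs) = ∈-++⁺ʳ as fy∈bs

-- Finite subsets

elements : ∀ {n} → Subset n → List (Fin n)
elements []            = []
elements (inside ∷ p)  = zero ∷ map suc (elements p)
elements (outside ∷ p) = map suc (elements p)

length-elements : ∀ {n} (p : Subset n) → length (elements p) ≡ ∣ p ∣
length-elements []            = refl
length-elements (inside ∷ p)  = cong suc (trans (length-map suc (elements p)) (length-elements p))
length-elements (outside ∷ p) = trans (length-map suc (elements p)) (length-elements p)

∈-elements⁺ : ∀ {n} {x : Fin n} {p} → x ∈ₛ p → x ∈ elements p
∈-elements⁺                   here        = here refl
∈-elements⁺ {p = inside ∷ p}  (there x∈p) = there (∈-map⁺ suc (∈-elements⁺ x∈p))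
∈-elements⁺ {p = outside ∷ p} (there x∈p) = ∈-map⁺ suc (∈-elements⁺ x∈p)

∈-elements⁻ : ∀ {n} {x : Fin n} p → x ∈ elements p → x ∈ₛ p
∈-elements⁻ (inside ∷ p)  (here refl) = here
∈-elements⁻ (inside ∷ p)  (there x∈) with y , y∈ , refl ← ∈-map⁻ suc x∈ = there (∈-elements⁻ p y∈)
∈-elements⁻ (outside ∷ p) x∈         with y , y∈ , refl ← ∈-map⁻ suc x∈ = there (∈-elements⁻ p y∈)

elements-unique : ∀ {n} (p : Subset n) → Unique (elements p)
elements-unique []            = []
elements-unique (inside ∷ p)  = All.map⁺ (All.universal (λ _ ()) _) ∷ Unique.map⁺ suc-injective (elements-unique p)
elements-unique (outside ∷ p) = Unique.map⁺ suc-injective (elements-unique p)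

unique⇒length≤∣∣ : ∀ {n} {xs : List (Fin n)} → Unique xs → (p : Subset n) → (∀ {x} → x ∈ xs → x ∈ₛ p) →
                   length xs ≤ ∣ p ∣
unique⇒length≤∣∣ unique p xs⊆p = ≤-trans
  (injection⇒length≤ id id unique (elements p) (∈-elements⁺ ∘ xs⊆p)) (≤-reflexive (length-elements p))

injection⇒∣∣≤ : ∀ {n} (f : Fin n → Fin n) → (∀ {x y} → f x ≡ f y → x ≡ y) → (p q : Subset n) →
                (∀ {x} → x ∈ₛ p → f x ∈ₛ q) → ∣ p ∣ ≤ ∣ q ∣
injection⇒∣∣≤ f inj p q into = begin
  ∣ p ∣                ≡⟨ length-elements p ⟨
  length (elements p)  ≤⟨ injection⇒length≤ f inj (elements-unique p) (elements q)
                            (∈-elements⁺ ∘ into ∘ ∈-elements⁻ p) ⟩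
  length (elements q)  ≡⟨ length-elements q ⟩
  ∣ q ∣                ∎
  where open ≤-Reasoning

subsets : ∀ n → List (Subset n)
subsets zero    = [] ∷ []
subsets (suc n) = map (inside ∷_) (subsets n) ++ map (outside ∷_) (subsets n)

∈-subsets : ∀ {n} (p : Subset n) → p ∈ subsets n
∈-subsets []            = here refl
∈-subsets (inside ∷ p)  = ∈-++⁺ˡ (∈-map⁺ (inside ∷_) (∈-subsets p))
∈-subsets (outside ∷ p) = ∈-++⁺ʳ (map (inside ∷_) (subsets _)) (∈-map⁺ (outside ∷_) (∈-subsets p))

subsets-unique : ∀ n → Unique (subsets n)
subsets-unique zero    = [] ∷ []
subsets-unique (suc n) = Unique.++⁺ (Unique.map⁺ ∷-injectiveʳ (subsets-unique n))
                                    (Unique.map⁺ ∷-injectiveʳ (subsets-unique n)) disjoint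
  where
  disjoint : ∀ {p} → ¬ (p ∈ map (inside ∷_) (subsets n) × p ∈ map (outside ∷_) (subsets n))
  disjoint (p∈ , p∈′) with ∈-map⁻ (inside ∷_) p∈ | ∈-map⁻ (outside ∷_) p∈′
  ... | _ , _ , refl | _ , _ , ()

∣p∪⁅x⁆∣≤1+∣p∣ : ∀ {n} (p : Subset n) x → ∣ p ∪ ⁅ x ⁆ ∣ ≤ suc ∣ p ∣
∣p∪⁅x⁆∣≤1+∣p∣ (inside ∷ p)  zero    rewrite ∪-identityʳ p = n≤1+n _
∣p∪⁅x⁆∣≤1+∣p∣ (outside ∷ p) zero    rewrite ∪-identityʳ p = ≤-refl
∣p∪⁅x⁆∣≤1+∣p∣ (inside ∷ p)  (suc x) = s≤s (∣p∪⁅x⁆∣≤1+∣p∣ p x)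
∣p∪⁅x⁆∣≤1+∣p∣ (outside ∷ p) (suc x) = ∣p∪⁅x⁆∣≤1+∣p∣ p x

∣p∣≤1+∣p-x∣ : ∀ {n} (p : Subset n) x → ∣ p ∣ ≤ suc ∣ p - x ∣
∣p∣≤1+∣p-x∣ p x = ≤-trans (p⊆q⇒∣p∣≤∣q∣ p⊆) (∣p∪⁅x⁆∣≤1+∣p∣ (p - x) x)
  where
  p⊆ : p ⊆ (p - x) ∪ ⁅ x ⁆
  p⊆ {z} z∈p with z ≟ᶠ x
  ... | yes refl = q⊆p∪q (p - x) ⁅ x ⁆ (x∈⁅x⁆ x)
  ... | no  z≢x  = p⊆p∪q ⁅ x ⁆ (x∈p∧x≢y⇒x∈p-y z∈p z≢x)

∣p∣<∣p∪⁅x⁆∣ : ∀ {n} {p : Subset n} {x} → x ∉ₛ p → ∣ p ∣ < ∣ p ∪ ⁅ x ⁆ ∣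
∣p∣<∣p∪⁅x⁆∣ {p = p} {x} x∉p = p⊂q⇒∣p∣<∣q∣ (p⊆p∪q ⁅ x ⁆ , x , q⊆p∪q p ⁅ x ⁆ (x∈⁅x⁆ x) , x∉p)

∣q∣≤∣q∩p∣⇒q⊆p : ∀ {n} {p q : Subset n} → ∣ q ∣ ≤ ∣ q ∩ p ∣ → q ⊆ p
∣q∣≤∣q∩p∣⇒q⊆p {p = p} {q} q≤ {x} x∈q with x ∈? p
... | yes x∈p = x∈p
... | no  x∉p = contradiction
  (p⊂q⇒∣p∣<∣q∣ (p∩q⊆p q p , x , x∈q , x∉p ∘ proj₂ ∘ x∈p∩q⁻ q p)) (≤⇒≯ q≤)

-- Removing `q` a second time changes nothing, whereas a point of `q` left in `p ─ q` would make the
-- set strictly smaller.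
x∈p─q⇒x∉q : ∀ {n} (p q : Subset n) {x} → x ∈ₛ p ─ q → x ∉ₛ q
x∈p─q⇒x∉q p q x∈p─q x∈q = <⇒≢ (p∩q≢∅⇒∣p─q∣<∣p∣ (p ─ q) q (_ , x∈p∩q⁺ (x∈p─q , x∈q)))
  (cong ∣_∣ (p─q─q≡p─q p q))

x∉p-x : ∀ {n} (p : Subset n) x → x ∉ₛ p - x
x∉p-x p x x∈ = x∈p─q⇒x∉q p ⁅ x ⁆ x∈ (x∈⁅x⁆ x)

0<∣p∣⇒nonempty : ∀ {n} (p : Subset n) → 0 < ∣ p ∣ → ∃ λ x → x ∈ₛ p
0<∣p∣⇒nonempty {n} p 0<∣p∣ with nonempty? p
... | yes ne = ne
... | no  ¬ne rewrite Empty-unique ¬ne | ∣⊥∣≡0 n = contradiction 0<∣p∣ λ ()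

-- Swapping two points

transpose-cases : ∀ {n} (x y z : Fin n) →
  (z ≡ x × transpose x y z ≡ y) ⊎ (z ≡ y × transpose x y z ≡ x) ⊎ (z ≢ x × z ≢ y × transpose x y z ≡ z)
transpose-cases x y z with z ≟ᶠ x
... | yes z≡x = inj₁ (z≡x , refl)
... | no  z≢x with z ≟ᶠ y
...   | yes z≡y = inj₂ (inj₁ (z≡y , refl))
...   | no  z≢y = inj₂ (inj₂ (z≢x , z≢y , refl))

transpose-injective : ∀ {n} (x y : Fin n) {u v} → transpose x y u ≡ transpose x y v → u ≡ v
transpose-injective x y eq = trans (sym (transpose-inverse y x))
  (trans (cong (transpose y x) eq) (transpose-inverse y x))

-- Formed as a preimage, which agrees with the image because a transposition is an involution;
-- membership is then a plain lookup.
swap : ∀ {n} → Fin n → Fin n → Subset n → Subset n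
swap x y p = tabulate (lookup p ∘ transpose x y)

∈-swap⁺ : ∀ {n} (x y : Fin n) {z} p → transpose x y z ∈ₛ p → z ∈ₛ swap x y p
∈-swap⁺ x y {z} p z∈ = lookup⇒[]= z _ (trans (lookup∘tabulate _ z) ([]=⇒lookup z∈))

∈-swap⁻ : ∀ {n} (x y : Fin n) {z} p → z ∈ₛ swap x y p → transpose x y z ∈ₛ p
∈-swap⁻ x y {z} p z∈ = lookup⇒[]= _ p (trans (sym (lookup∘tabulate _ z)) ([]=⇒lookup z∈))

swap-inverse : ∀ {n} (x y : Fin n) p → swap y x (swap x y p) ≡ p
swap-inverse x y p = trans (tabulate-cong pointwise) (tabulate∘lookup p)
  where
  pointwise : ∀ z → lookup (swap x y p) (transpose y x z) ≡ lookup p z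
  pointwise z = trans (lookup∘tabulate _ (transpose y x z)) (cong (lookup p) (transpose-inverse x y))

swap-injective : ∀ {n} (x y : Fin n) {p q} → swap x y p ≡ swap x y q → p ≡ q
swap-injective x y {p} {q} eq = trans (sym (swap-inverse x y p)) (trans (cong (swap y x) eq) (swap-inverse x y q))

-- When `q` contains both points or neither, the transposition preserves `q` and so injects
-- `swap x y p ∩ q` into `p ∩ q`. The reverse inequality is the same fact for `swap x y p`, which
-- swaps back to `p`.
∣swap∩∣ : ∀ {n} (x y : Fin n) (p q : Subset n) → (x ∈ₛ q → y ∈ₛ q) → (y ∈ₛ q → x ∈ₛ q) →
          ∣ swap x y p ∩ q ∣ ≡ ∣ p ∩ q ∣
∣swap∩∣ x y p q x⇒y y⇒x = ≤-antisym (swap≤ x y p x⇒y y⇒x)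
  (subst (λ r → ∣ r ∩ q ∣ ≤ ∣ swap x y p ∩ q ∣) (swap-inverse x y p) (swap≤ y x (swap x y p) y⇒x x⇒y))
  where
  swap≤ : ∀ x y p → (x ∈ₛ q → y ∈ₛ q) → (y ∈ₛ q → x ∈ₛ q) → ∣ swap x y p ∩ q ∣ ≤ ∣ p ∩ q ∣
  swap≤ x y p x⇒y y⇒x = injection⇒∣∣≤ (transpose x y) (transpose-injective x y) _ _ into
    where
    transpose∈q : ∀ {z} → z ∈ₛ q → transpose x y z ∈ₛ q
    transpose∈q {z} z∈q with transpose-cases x y z
    ... | inj₁ (refl , eq)           = subst (_∈ₛ q) (sym eq) (x⇒y z∈q)
    ... | inj₂ (inj₁ (refl , eq))    = subst (_∈ₛ q) (sym eq) (y⇒x z∈q)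
    ... | inj₂ (inj₂ (_ , _ , eq))   = subst (_∈ₛ q) (sym eq) z∈q
    into : ∀ {z} → z ∈ₛ swap x y p ∩ q → transpose x y z ∈ₛ p ∩ q
    into z∈ with z∈p , z∈q ← x∈p∩q⁻ (swap x y p) q z∈ = x∈p∩q⁺ (∈-swap⁻ x y p z∈p , transpose∈q z∈q)

-- Degrees of sets in a family closed under swaps

module _ {n} (𝓗 : List (Subset n)) (unique : Unique 𝓗) where

  degree : Subset n → ℕ
  degree S = count (S ⊆?_) 𝓗

  -- Send `H ⊇ S` to `swap x y H`. The result contains `y` because `x ∈ H`, and every point of
  -- `S - x` is either `y` or fixed by the swap, so it survives.
  degree-swap : ∀ {S x y} → x ∈ₛ S → (∀ {H} → H ∈ 𝓗 → swap x y H ∈ 𝓗) →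
                degree S ≤ count (λ H → y ∈? H) (filter (S - x ⊆?_) 𝓗)
  degree-swap {S} {x} {y} x∈S closed = injection⇒length≤ (swap x y) (swap-injective x y)
    (Unique.filter⁺ (S ⊆?_) unique) _ into
    where
    into : ∀ {H} → H ∈ filter (S ⊆?_) 𝓗 → swap x y H ∈ filter (λ H → y ∈? H) (filter (S - x ⊆?_) 𝓗)
    into {H} H∈ with H∈𝓗 , S⊆H ← ∈-filter⁻ (S ⊆?_) H∈ =
      ∈-filter⁺ (λ H → y ∈? H) (∈-filter⁺ (S - x ⊆?_) (closed H∈𝓗) S-x⊆) y∈
      where
      y∈ : y ∈ₛ swap x y H
      y∈ with transpose-cases x y y
      ... | inj₁ (refl , eq)          = ∈-swap⁺ x y H (subst (_∈ₛ H) (sym eq) (S⊆H x∈S))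
      ... | inj₂ (inj₁ (_ , eq))      = ∈-swap⁺ x y H (subst (_∈ₛ H) (sym eq) (S⊆H x∈S))
      ... | inj₂ (inj₂ (_ , y≢y , _)) = contradiction refl y≢y
      S-x⊆ : S - x ⊆ swap x y H
      S-x⊆ {z} z∈ with transpose-cases x y z
      ... | inj₁ (refl , _)           = contradiction z∈ (x∉p-x S x)
      ... | inj₂ (inj₁ (_ , eq))      = ∈-swap⁺ x y H (subst (_∈ₛ H) (sym eq) (S⊆H x∈S))
      ... | inj₂ (inj₂ (_ , _ , eq))  = ∈-swap⁺ x y H (subst (_∈ₛ H) (sym eq) (S⊆H (p─q⊆p S ⁅ x ⁆ z∈)))

  -- Summing degree-swap over y ∈ Y counts each H ⊇ S - x exactly |H ∩ Y| times.
  degree-extension : ∀ {S x} (Y : Subset n) {b} → x ∈ₛ S →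
                     (∀ {y H} → y ∈ₛ Y → H ∈ 𝓗 → swap x y H ∈ 𝓗) →
                     (∀ {H} → H ∈ 𝓗 → ∣ H ∩ Y ∣ ≤ b) →
                     degree S * ∣ Y ∣ ≤ b * degree (S - x)
  degree-extension {S} {x} Y {b} x∈S closed meet = begin
    degree S * ∣ Y ∣                                    ≡⟨ *-comm (degree S) ∣ Y ∣ ⟩
    ∣ Y ∣ * degree S                                    ≡⟨ cong (_* degree S) (length-elements Y) ⟨
    length ys * degree S                                ≤⟨ ∑-mono-lower ys below ⟩
    ∑ ys (λ y → count (λ H → y ∈? H) 𝓗′)                ≡⟨ double-count (λ y H → y ∈? H) 𝓗′ ys ⟩
    ∑ 𝓗′ (λ H → count (_∈? H) ys)                       ≡⟨ *-identityʳ _ ⟨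
    ∑ 𝓗′ (λ H → count (_∈? H) ys) * 1                   ≤⟨ ∑-mono 𝓗′ (≤-trans (≤-reflexive (*-identityʳ _)) ∘ meets) ⟩
    degree (S - x) * b                                  ≡⟨ *-comm (degree (S - x)) b ⟩
    b * degree (S - x)                                  ∎
    where
    open ≤-Reasoning
    ys = elements Y
    𝓗′ = filter (S - x ⊆?_) 𝓗
    below : ∀ {y} → y ∈ ys → degree S ≤ count (λ H → y ∈? H) 𝓗′
    below y∈ = degree-swap x∈S (closed (∈-elements⁻ Y y∈))
    meets : ∀ {H} → H ∈ 𝓗′ → count (_∈? H) ys ≤ b
    meets {H} H∈ = ≤-trans
      (unique⇒length≤∣∣ (Unique.filter⁺ (_∈? H) (elements-unique Y)) (H ∩ Y)
        (λ y∈ → case ∈-filter⁻ (_∈? H) y∈ of λ (y∈Y , y∈H) → x∈p∩q⁺ (y∈H , ∈-elements⁻ Y y∈Y)))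
      (meet (proj₁ (∈-filter⁻ (S - x ⊆?_) H∈)))

-- t-transversals

module _ {n} (t : ℕ) (𝓕 : List (Subset n)) where

  Transversal : Subset n → Set
  Transversal S = All (λ F → t ≤ ∣ S ∩ F ∣) 𝓕

  transversal? : Decidable Transversal
  transversal? S = All.all? (λ F → t ≤? ∣ S ∩ F ∣) 𝓕

  -- For an empty `𝓕` every set is a transversal; the bound `t ≤ ∣ B ∣` keeps the minimum from
  -- dropping below `t` there.
  IsMinimum : Subset n → Set
  IsMinimum B = t ≤ ∣ B ∣ × Transversal B × (∀ S → t ≤ ∣ S ∣ → Transversal S → ∣ B ∣ ≤ ∣ S ∣)

  -- Descent on the size: finitely many subsets make the existence of a smaller transversal
  -- decidable, and either it is taken or `B` is minimum.
  minimum-below : ∀ m B → ∣ B ∣ ≡ m → t ≤ ∣ B ∣ → Transversal B → ∃ IsMinimum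
  minimum-below = <-rec _ step
    where
    step : ∀ m → (∀ {k} → k < m → ∀ B → ∣ B ∣ ≡ k → t ≤ ∣ B ∣ → Transversal B → ∃ IsMinimum) →
           ∀ B → ∣ B ∣ ≡ m → t ≤ ∣ B ∣ → Transversal B → ∃ IsMinimum
    step m rec B refl t≤B trB with anySubset? (λ S → t ≤? ∣ S ∣ ×-dec transversal? S ×-dec ∣ S ∣ <? ∣ B ∣)
    ... | yes (S , t≤S , trS , S<B) = rec S<B S refl t≤S trS
    ... | no  ∄S = B , t≤B , trB , λ S t≤S trS → ≮⇒≥ λ S<B → ∄S (S , t≤S , trS , S<B)

-- Bounding a maximum family through a minimum transversal

module _ {n} (t K b N : ℕ) (𝓗 𝓕 : List (Subset n)) (𝓗-unique : Unique 𝓗) (𝓕-unique : Unique 𝓕)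
         (𝓕⊆𝓗 : ∀ {F} → F ∈ 𝓕 → F ∈ 𝓗) (intersecting : tIntersecting t 𝓕) (K≥1 : 1 ≤ K)
         (∣F∣≤K : ∀ {F} → F ∈ 𝓕 → ∣ F ∣ ≤ K)
         (extension : ∀ {S x} → x ∈ₛ S → count (S ⊆?_) 𝓗 * N ≤ b * count (S - x ⊆?_) 𝓗)
         (maximum : ∀ {S} → t ≤ ∣ S ∣ → count (S ⊆?_) 𝓗 ≤ length 𝓕)
         where

  private
    L = length 𝓕

  -- Delete `j` points of `S` one at a time, each deletion paying a factor `b` against a factor `N`
  -- by `extension`. At least `t` points remain, so `maximum` bounds the last degree.
  large-degree-bound : ∀ j {S} → t + j ≤ ∣ S ∣ → count (S ⊆?_) 𝓗 * N ^ j ≤ b ^ j * L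
  large-degree-bound zero {S} t≤S = begin
    count (S ⊆?_) 𝓗 * 1  ≡⟨ *-identityʳ _ ⟩
    count (S ⊆?_) 𝓗      ≤⟨ maximum (≤-trans (m≤m+n t 0) t≤S) ⟩
    L                    ≡⟨ +-identityʳ L ⟨
    1 * L                ∎
    where open ≤-Reasoning
  large-degree-bound (suc j) {S} t+1+j≤S
    with x , x∈S ← 0<∣p∣⇒nonempty S (≤-trans (≤-trans (s≤s z≤n) (m≤n+m (suc j) t)) t+1+j≤S) = begin
    count (S ⊆?_) 𝓗 * (N * N ^ j)        ≡⟨ *-assoc (count (S ⊆?_) 𝓗) N (N ^ j) ⟨
    count (S ⊆?_) 𝓗 * N * N ^ j          ≤⟨ *-monoˡ-≤ (N ^ j) (extension x∈S) ⟩
    b * count (S - x ⊆?_) 𝓗 * N ^ j      ≡⟨ *-assoc b _ _ ⟩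
    b * (count (S - x ⊆?_) 𝓗 * N ^ j)    ≤⟨ *-monoʳ-≤ b (large-degree-bound j t+j≤) ⟩
    b * (b ^ j * L)                      ≡⟨ *-assoc b _ L ⟨
    b * b ^ j * L                        ∎
    where
    open ≤-Reasoning
    t+j≤ : t + j ≤ ∣ S - x ∣
    t+j≤ = s≤s⁻¹ (≤-trans (≤-reflexive (sym (+-suc t j))) (≤-trans t+1+j≤S (∣p∣≤1+∣p-x∣ S x)))

  module _ (j : ℕ) (minimal : ∀ S → t ≤ ∣ S ∣ → Transversal t 𝓕 S → t + j ≤ ∣ S ∣) where

    -- A set S with t ≤ |S| < t + j is no t-transversal, so some F ∈ 𝓕 meets it in fewer than t points,
    -- and every member of 𝓕 containing S contains one of the at most K points of F ─ S.
    grow : ∀ i {S} → t ≤ ∣ S ∣ → t + j ≤ ∣ S ∣ + i → count (S ⊆?_) 𝓕 * N ^ j ≤ K ^ i * (b ^ j * L)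
    grow i {S} t≤S t+j≤ with t + j ≤? ∣ S ∣
    -- `i` is the number of enlargements still allowed. If `S` is large enough before they are used
    -- up, the leftover factor `K ^ i` is at least 1 and only weakens the bound.
    ... | yes t+j≤S = begin
      count (S ⊆?_) 𝓕 * N ^ j  ≤⟨ *-monoˡ-≤ (N ^ j)
                                     (injection⇒length≤ id id (Unique.filter⁺ (S ⊆?_) 𝓕-unique) _ into) ⟩
      count (S ⊆?_) 𝓗 * N ^ j  ≤⟨ large-degree-bound j t+j≤S ⟩
      b ^ j * L                ≤⟨ m≤n*m _ (K ^ i) {{m^n≢0 K i {{>-nonZero K≥1}}}} ⟩
      K ^ i * (b ^ j * L)      ∎
      where
      open ≤-Reasoning
      into : ∀ {F} → F ∈ filter (S ⊆?_) 𝓕 → F ∈ filter (S ⊆?_) 𝓗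
      into F∈ with F∈𝓕 , S⊆F ← ∈-filter⁻ (S ⊆?_) F∈ = ∈-filter⁺ (S ⊆?_) (𝓕⊆𝓗 F∈𝓕) S⊆F
    grow zero    {S} t≤S t+j≤ | no t+j≰S = contradiction (≤-trans t+j≤ (≤-reflexive (+-identityʳ _))) t+j≰S
    grow (suc i) {S} t≤S t+j≤ | no t+j≰S
      with F , F∈𝓕 , t≰S∩F ← find (All.¬All⇒Any¬ (λ F → t ≤? ∣ S ∩ F ∣) 𝓕 (t+j≰S ∘ minimal S t≤S)) = begin
      count (S ⊆?_) 𝓕 * N ^ j
        ≤⟨ count≤-cover (S ⊆?_) (λ x → S ∪ ⁅ x ⁆ ⊆?_) 𝓕 (elements (F ─ S)) cover bound ⟩
      length (elements (F ─ S)) * (K ^ i * (b ^ j * L))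
        ≤⟨ *-monoˡ-≤ _ (≤-trans (≤-reflexive (length-elements (F ─ S)))
                                (≤-trans (p⊆q⇒∣p∣≤∣q∣ (p─q⊆p F S)) (∣F∣≤K F∈𝓕))) ⟩
      K * (K ^ i * (b ^ j * L))
        ≡⟨ *-assoc K _ _ ⟨
      K * K ^ i * (b ^ j * L) ∎
      where
      open ≤-Reasoning
      cover : ∀ {G} → G ∈ 𝓕 → S ⊆ G → ∃ λ x → x ∈ elements (F ─ S) × S ∪ ⁅ x ⁆ ⊆ G
      cover {G} G∈𝓕 S⊆G with any? (λ x → x ∈? F ×-dec x ∈? G ×-dec ¬? (x ∈? S))
      ... | yes (x , x∈F , x∈G , x∉S) = x , ∈-elements⁺ (x∈p∧x∉q⇒x∈p─q x∈F x∉S) , λ z∈ →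
        [ S⊆G , (λ z∈⁅x⁆ → subst (_∈ₛ G) (sym (x∈⁅y⁆⇒x≡y x z∈⁅x⁆)) x∈G) ]′ (x∈p∪q⁻ S ⁅ x ⁆ z∈)
      -- If `G` had no point of `F ─ S`, then `F ∩ G` would lie in `S ∩ F`, which has fewer than `t`
      -- points by the choice of `F`.
      ... | no ∄x = contradiction (≤-trans (intersecting F∈𝓕 G∈𝓕) (p⊆q⇒∣p∣≤∣q∣ F∩G⊆S∩F)) t≰S∩F
        where
        F∩G⊆S∩F : F ∩ G ⊆ S ∩ F
        F∩G⊆S∩F {x} x∈ with x∈F , x∈G ← x∈p∩q⁻ F G x∈ with x ∈? S
        ... | yes x∈S = x∈p∩q⁺ (x∈S , x∈F)
        ... | no  x∉S = contradiction (x , x∈F , x∈G , x∉S) ∄x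
      bound : ∀ {x} → x ∈ elements (F ─ S) → count (S ∪ ⁅ x ⁆ ⊆?_) 𝓕 * N ^ j ≤ K ^ i * (b ^ j * L)
      bound {x} x∈ = grow i {S ∪ ⁅ x ⁆} (≤-trans t≤S (<⇒≤ S<))
        (≤-trans t+j≤ (≤-trans (≤-reflexive (+-suc ∣ S ∣ i)) (+-monoˡ-≤ i S<)))
        where
        S< : ∣ S ∣ < ∣ S ∪ ⁅ x ⁆ ∣
        S< = ∣p∣<∣p∪⁅x⁆∣ (x∈p─q⇒x∉q F S (∈-elements⁻ (F ─ S) x∈))

    -- Among any t + 1 points of B, one can be deleted without spoiling |B ∩ G| ≥ t: a point outside G
    -- if there is one, and an arbitrary one otherwise.
    shrink : ∀ i {B} → ∣ B ∣ ≤ t + i →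
             count (λ G → t ≤? ∣ B ∩ G ∣) 𝓕 * N ^ j ≤ suc t ^ i * (K ^ j * (b ^ j * L))
    shrink i {B} B≤ with ∣ B ∣ ≤? t
    ... | yes B≤t with t ≤? ∣ B ∣
    -- A set with fewer than `t` points meets no `G` in `t` points, so the empty list is a cover and
    -- the left side is 0.
    ...   | no t≰B = ≤-trans (count≤-cover {B = Subset n} (λ G → t ≤? ∣ B ∩ G ∣) _⊆?_ 𝓕 [] {m = 0}
              (λ _ t≤ → contradiction (≤-trans t≤ (∣p∩q∣≤∣p∣ B _)) t≰B) λ ()) z≤n
    -- Here `B` has exactly `t` points, so meeting `B` in `t` points means containing it, and `j`
    -- enlargements lead from size `t` to `t + j`.
    ...   | yes t≤B = begin
      count (λ G → t ≤? ∣ B ∩ G ∣) 𝓕 * N ^ j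
        ≤⟨ *-monoˡ-≤ (N ^ j) (count-mono _ (B ⊆?_) 𝓕 λ _ t≤ → ∣q∣≤∣q∩p∣⇒q⊆p (≤-trans B≤t t≤)) ⟩
      count (B ⊆?_) 𝓕 * N ^ j
        ≤⟨ grow j t≤B (+-monoˡ-≤ j t≤B) ⟩
      K ^ j * (b ^ j * L)
        ≤⟨ m≤n*m _ (suc t ^ i) {{m^n≢0 (suc t) i}} ⟩
      suc t ^ i * (K ^ j * (b ^ j * L)) ∎
      where open ≤-Reasoning
    shrink zero    {B} B≤ | no B≰t = contradiction (≤-trans B≤ (≤-reflexive (+-identityʳ t))) B≰t
    shrink (suc i) {B} B≤ | no B≰t = begin
      count (λ G → t ≤? ∣ B ∩ G ∣) 𝓕 * N ^ j
        ≤⟨ count≤-cover (λ G → t ≤? ∣ B ∩ G ∣) (λ x G → t ≤? ∣ (B - x) ∩ G ∣) 𝓕 xs cover bound ⟩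
      length xs * (suc t ^ i * (K ^ j * (b ^ j * L)))
        ≡⟨ cong (_* _) length-xs ⟩
      suc t * (suc t ^ i * (K ^ j * (b ^ j * L)))
        ≡⟨ *-assoc (suc t) (suc t ^ i) _ ⟨
      suc t * suc t ^ i * (K ^ j * (b ^ j * L)) ∎
      where
      open ≤-Reasoning
      xs = take (suc t) (elements B)
      length-xs : length xs ≡ suc t
      length-xs = trans (length-take (suc t) (elements B))
        (m≤n⇒m⊓n≡m (≤-trans (≰⇒> B≰t) (≤-reflexive (sym (length-elements B)))))
      xs⊆B : ∀ {x} → x ∈ xs → x ∈ₛ B
      xs⊆B x∈ = All.lookup (All.take⁺ (suc t) (All.tabulate (∈-elements⁻ B))) x∈
      cover : ∀ {G} → G ∈ 𝓕 → t ≤ ∣ B ∩ G ∣ → ∃ λ x → x ∈ xs × t ≤ ∣ (B - x) ∩ G ∣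
      cover {G} _ t≤ with Any.any? (λ x → ¬? (x ∈? G)) xs
      ... | yes any with x , x∈xs , x∉G ← find any = x , x∈xs ,
        ≤-trans t≤ (p⊆q⇒∣p∣≤∣q∣ {p = B ∩ G} {q = (B - x) ∩ G} λ z∈ →
          case x∈p∩q⁻ B G z∈ of λ (z∈B , z∈G) → x∈p∩q⁺ (x∈p∧x≢y⇒x∈p-y z∈B (λ { refl → x∉G z∈G }) , z∈G))
      -- All `t + 1` chosen points lie in `G`, so `B ∩ G` has at least `t + 1` points and can lose
      -- any one of them.
      ... | no ¬any with x , x∈xs ← length≡suc⇒∃∈ xs length-xs = x , x∈xs , s≤s⁻¹ (begin
        suc t                        ≡⟨ length-xs ⟨
        length xs                    ≤⟨ unique⇒length≤∣∣ (Unique.take⁺ (suc t) (elements-unique B)) (B ∩ G) xs⊆B∩G ⟩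
        ∣ B ∩ G ∣                    ≤⟨ ∣p∣≤1+∣p-x∣ (B ∩ G) x ⟩
        suc ∣ B ∩ G - x ∣            ≤⟨ s≤s (p⊆q⇒∣p∣≤∣q∣ B∩G-x⊆) ⟩
        suc ∣ (B - x) ∩ G ∣          ∎)
        where
        xs⊆B∩G : ∀ {z} → z ∈ xs → z ∈ₛ B ∩ G
        xs⊆B∩G {z} z∈ = x∈p∩q⁺ (xs⊆B z∈ , Dec.decidable-stable (z ∈? G) (λ z∉G → ¬any (lose z∈ z∉G)))
        B∩G-x⊆ : B ∩ G - x ⊆ (B - x) ∩ G
        B∩G-x⊆ {z} z∈ with z∈B , z∈G ← x∈p∩q⁻ B G (p─q⊆p (B ∩ G) ⁅ x ⁆ z∈) =
          x∈p∩q⁺ (x∈p∧x≢y⇒x∈p-y z∈B (λ { refl → x∉p-x (B ∩ G) x z∈ }) , z∈G)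
      bound : ∀ {x} → x ∈ xs → count (λ G → t ≤? ∣ (B - x) ∩ G ∣) 𝓕 * N ^ j ≤ suc t ^ i * (K ^ j * (b ^ j * L))
      bound {x} x∈ = shrink i {B - x}
        (s≤s⁻¹ (≤-trans (x∈p⇒∣p-x∣<∣p∣ (xs⊆B x∈)) (≤-trans B≤ (≤-reflexive (+-suc t i)))))

  maximum-trivial : suc t * (K * b) < N → t ≤ n → trivial t 𝓕
  maximum-trivial small t≤n
    -- The descent starts from the whole ground set: it meets `F` in all of `F`, and `F` has at
    -- least `t` points since it `t`-intersects itself.
    with B , t≤B , trB , minB ← minimum-below t 𝓕 ∣ ⊤ {n} ∣ ⊤ refl (≤-trans t≤n (≤-reflexive (sym (∣⊤∣≡n n))))
      (All.tabulate λ {F} F∈ → ≤-trans (intersecting F∈ F∈)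
        (p⊆q⇒∣p∣≤∣q∣ λ z∈ → x∈p∩q⁺ (∈⊤ , proj₁ (x∈p∩q⁻ F F z∈))))
    with ∣ B ∣ ≤? t
  ... | yes B≤t = B , ≤-antisym B≤t t≤B , λ F∈ → ∣q∣≤∣q∩p∣⇒q⊆p (≤-trans B≤t (All.lookup trB F∈))
  -- The strict inequality `small` survives the `j`-th power because `j` is positive, and the
  -- multiplication by `L` because `𝓕` is non-empty.
  ... | no  B≰t = contradiction too-small (<⇒≱
    (*-monoˡ-< L {{>-nonZero (0<L 𝓕 minB)}} (^-monoˡ-< j {{>-nonZero (m<n⇒0<n∸m (≰⇒> B≰t))}} small)))
    where
    open ≤-Reasoning
    j = ∣ B ∣ ∸ t
    t+j≡ : t + j ≡ ∣ B ∣
    t+j≡ = m+[n∸m]≡n t≤B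
    -- Generalised to `𝓔` so that the list can be matched on. For the empty family `B - x` is
    -- vacuously a transversal, still with at least `t` points but smaller than `B`.
    0<L : ∀ 𝓔 → (∀ S → t ≤ ∣ S ∣ → Transversal t 𝓔 S → ∣ B ∣ ≤ ∣ S ∣) → 0 < length 𝓔
    0<L (_ ∷ _) _ = s≤s z≤n
    0<L []      m with x , x∈B ← 0<∣p∣⇒nonempty B (≤-trans (s≤s z≤n) (≰⇒> B≰t)) =
      contradiction (x∈p⇒∣p-x∣<∣p∣ x∈B) (≤⇒≯ (m (B - x) (s≤s⁻¹ (≤-trans (≰⇒> B≰t) (∣p∣≤1+∣p-x∣ B x))) []))
    minimal : ∀ S → t ≤ ∣ S ∣ → Transversal t 𝓕 S → t + j ≤ ∣ S ∣
    minimal S t≤S trS = ≤-trans (≤-reflexive t+j≡) (minB S t≤S trS)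
    regroup : ∀ a c d e → a * (c * (d * e)) ≡ a * (c * d) * e
    regroup = solve-∀
    too-small : N ^ j * L ≤ (suc t * (K * b)) ^ j * L
    too-small = begin
      N ^ j * L                                  ≡⟨ *-comm (N ^ j) L ⟩
      -- `B` is a transversal, so the filter keeps every member of `𝓕`.
      L * N ^ j                                  ≡⟨ cong (λ 𝓔 → length 𝓔 * N ^ j) (filter-all (λ G → t ≤? ∣ B ∩ G ∣) trB) ⟨
      count (λ G → t ≤? ∣ B ∩ G ∣) 𝓕 * N ^ j     ≤⟨ shrink j minimal j {B} (≤-reflexive (sym t+j≡)) ⟩
      suc t ^ j * (K ^ j * (b ^ j * L))          ≡⟨ regroup (suc t ^ j) (K ^ j) (b ^ j) L ⟩
      suc t ^ j * (K ^ j * b ^ j) * L            ≡⟨ cong (λ e → suc t ^ j * e * L) (^-distribʳ-* K b j) ⟨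
      suc t ^ j * (K * b) ^ j * L                ≡⟨ cong (_* L) (^-distribʳ-* (suc t) (K * b) j) ⟨
      (suc t * (K * b)) ^ j * L                  ∎

-- Blocks

interval-size : ∀ n lo m → lo + m ≤ n → ∣ tabulate {n = n} (λ x → (lo ≤ᵇ toℕ x) ∧ (toℕ x <ᵇ lo + m)) ∣ ≡ m
interval-size zero    zero     zero    _ = refl
interval-size (suc n) zero     zero    _ = interval-size n zero zero z≤n
interval-size (suc n) zero     (suc m) (s≤s m≤n) = cong suc (interval-size n zero m m≤n)
-- The lower end 1 is split off because `_≤ᵇ_` reduces to `_<ᵇ_` on a successor: only after this
-- split does shifting the interval by one hold by computation.
interval-size (suc n) (suc zero)     m (s≤s lo+m≤n) = interval-size n zero m lo+m≤n
interval-size (suc n) (suc (suc lo)) m (s≤s lo+m≤n) = interval-size n (suc lo) m lo+m≤n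

lower+≤total : ∀ {p} (ns : Fin p → ℕ) i → lower ns i + ns i ≤ total p ns
lower+≤total ns zero    = m≤m+n (ns zero) _
lower+≤total ns (suc i) = ≤-trans (≤-reflexive (+-assoc (ns zero) _ _))
  (+-monoʳ-≤ (ns zero) (lower+≤total (ns ∘ suc) i))

∣block∣ : ∀ {p} (ns : Fin p → ℕ) i → ∣ block ns i ∣ ≡ ns i
∣block∣ {p} ns i = interval-size (total p ns) (lower ns i) (ns i) (lower+≤total ns i)

InBlock : ∀ {p} → (Fin p → ℕ) → Fin p → ℕ → Set
InBlock ns i k = lower ns i ≤ k × k < lower ns i + ns i

∈-block⁺ : ∀ {p} (ns : Fin p → ℕ) i {x} → InBlock ns i (toℕ x) → x ∈ₛ block ns i
∈-block⁺ ns i {x} (lo≤x , x<hi) = lookup⇒[]= x _ (trans (lookup∘tabulate _ x)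
  (Equivalence.to T-≡ (Equivalence.from T-∧ (≤⇒≤ᵇ lo≤x , <⇒<ᵇ x<hi))))

∈-block⁻ : ∀ {p} (ns : Fin p → ℕ) i {x} → x ∈ₛ block ns i → InBlock ns i (toℕ x)
∈-block⁻ ns i {x} x∈
  with lo≤x , x<hi ← Equivalence.to T-∧ (Equivalence.from T-≡ (trans (sym (lookup∘tabulate _ x)) ([]=⇒lookup x∈))) =
  ≤ᵇ⇒≤ _ _ lo≤x , <ᵇ⇒< _ _ x<hi

inBlock-suc⁻ : ∀ {p} (ns : Fin (suc p) → ℕ) i {k} → InBlock ns (suc i) (ns zero + k) → InBlock (ns ∘ suc) i k
inBlock-suc⁻ ns i (lo≤ , <hi) = +-cancelˡ-≤ (ns zero) _ _ lo≤ ,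
  +-cancelˡ-< (ns zero) _ _ (≤-trans <hi (≤-reflexive (+-assoc (ns zero) _ _)))

inBlock-exists : ∀ {p} (ns : Fin p → ℕ) k → k < total p ns → ∃ λ i → InBlock ns i k
inBlock-exists {suc p} ns k k< with k <? ns zero
... | yes k<n₀ = zero , z≤n , k<n₀
... | no  k≮n₀ with i , lo≤ , <hi ← inBlock-exists (ns ∘ suc) (k ∸ ns zero)
                      (≤-trans (≤-reflexive (sym (+-∸-assoc 1 (≮⇒≥ k≮n₀)))) (m≤n+o⇒m∸n≤o (suc k) (ns zero) k<)) =
  suc i , ≤-trans (+-monoʳ-≤ (ns zero) lo≤) (≤-reflexive k≡) ,
  ≤-trans (s≤s (≤-reflexive (sym k≡))) (≤-trans (+-monoʳ-< (ns zero) <hi) (≤-reflexive (sym (+-assoc (ns zero) _ _))))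
  where
  k≡ : ns zero + (k ∸ ns zero) ≡ k
  k≡ = m+[n∸m]≡n (≮⇒≥ k≮n₀)

inBlock-unique : ∀ {p} (ns : Fin p → ℕ) i j {k} → InBlock ns i k → InBlock ns j k → i ≡ j
inBlock-unique ns zero    zero    _        _        = refl
inBlock-unique ns zero    (suc j) (_ , k<) (≤k , _) = contradiction (≤-trans (m≤m+n (ns zero) _) ≤k) (<⇒≱ k<)
inBlock-unique ns (suc i) zero    (≤k , _) (_ , k<) = contradiction (≤-trans (m≤m+n (ns zero) _) ≤k) (<⇒≱ k<)
inBlock-unique ns (suc i) (suc j) {k} k∈i  k∈j      = cong suc
  (inBlock-unique (ns ∘ suc) i j {k ∸ ns zero}
    (inBlock-suc⁻ ns i (shift (suc i) k∈i)) (inBlock-suc⁻ ns j (shift (suc j) k∈j)))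
  where
  -- Lying in a block after the first gives `ns zero ≤ k`, so `k` can be written as `ns zero` plus a
  -- remainder, the form that `inBlock-suc⁻` takes.
  shift : ∀ h → InBlock ns h k → InBlock ns h (ns zero + (k ∸ ns zero))
  shift h = subst (InBlock ns h) (sym (m+[n∸m]≡n (≤-trans (m≤m+n (ns zero) _) (proj₁ k∈i))))

-- Intersection profiles with the blocks

module _ {p} (ns : Fin p → ℕ) where

  hasProfile? : ∀ F r → Dec (hasProfile ns F r)
  hasProfile? F r = all? λ i → ∣ F ∩ block ns i ∣ ≟ r i

  inH2? : ∀ R → Decidable (inH2 ns R)
  inH2? R F = Dec.map′ (λ any → case find any of λ (r , r∈R , profile) → r , r∈R , profile)
                       (λ (r , r∈R , profile) → lose r∈R profile)
                       (Any.any? (hasProfile? F) R)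

  -- Blocks are disjoint, so each one contains both of `x` and `y` or neither, and every
  -- intersection size is preserved by `∣swap∩∣`.
  swap-inH2 : ∀ {R x y} i F → x ∈ₛ block ns i → y ∈ₛ block ns i → inH2 ns R F → inH2 ns R (swap x y F)
  swap-inH2 {x = x} {y} i F x∈i y∈i (r , r∈R , profile) = r , r∈R , λ j → trans
    (∣swap∩∣ x y F (block ns j) (move j x∈i y∈i) (move j y∈i x∈i)) (profile j)
    where
    move : ∀ {u v} j → u ∈ₛ block ns i → v ∈ₛ block ns i → u ∈ₛ block ns j → v ∈ₛ block ns j
    move {v = v} j u∈i v∈i u∈j =
      subst (λ h → v ∈ₛ block ns h) (inBlock-unique ns i j (∈-block⁻ ns i u∈i) (∈-block⁻ ns j u∈j)) v∈i

  -- The `p` blocks cover the ground set, so the size of `F` is at most the sum of its `p`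
  -- intersections with them.
  ∣F∣≤p*b : ∀ {b} F → (∀ i → ∣ F ∩ block ns i ∣ ≤ b) → ∣ F ∣ ≤ p * b
  ∣F∣≤p*b {b} F meet = begin
    ∣ F ∣                                                       ≡⟨ length-elements F ⟨
    length (elements F)                                         ≤⟨ length≤∑-cover (λ i → _∈? block ns i) _ (allFin p) cover ⟩
    ∑ (allFin p) (λ i → count (_∈? block ns i) (elements F))     ≡⟨ *-identityʳ _ ⟨
    ∑ (allFin p) (λ i → count (_∈? block ns i) (elements F)) * 1 ≤⟨ ∑-mono (allFin p) (λ {i} _ → bound i) ⟩
    length (allFin p) * b                                       ≡⟨ cong (_* b) (length-tabulate {n = p} id) ⟩
    p * b                                                       ∎
    where
    open ≤-Reasoning
    cover : ∀ {x} → x ∈ elements F → ∃ λ i → i ∈ allFin p × x ∈ₛ block ns i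
    cover {x} _ with i , x∈i ← inBlock-exists ns (toℕ x) (toℕ<n x) = i , ∈-allFin i , ∈-block⁺ ns i x∈i
    bound : ∀ i → count (_∈? block ns i) (elements F) * 1 ≤ b
    bound i = ≤-trans (≤-reflexive (*-identityʳ _)) (≤-trans
      (unique⇒length≤∣∣ (Unique.filter⁺ (_∈? block ns i) (elements-unique F)) (F ∩ block ns i)
        (λ x∈ → case ∈-filter⁻ (_∈? block ns i) x∈ of λ (x∈F , x∈i) → x∈p∩q⁺ (∈-elements⁻ F x∈F , x∈i)))
      (meet i))

-- The theorem for families with prescribed profiles

theorem1p4 : (p t : ℕ) → 1 ≤ p → 1 ≤ t →
    (ns : Fin p → ℕ) → (∀ i → 1 ≤ ns i) →
    (R : List (Fin p → ℕ)) → R ≢ [] → (∀ {r} → r ∈ R → ∀ i → 1 ≤ r i) →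
    (b c : ℕ) →
    (∀ {r} → r ∈ R → ∀ i → r i ≤ b) → Σ (Fin p → ℕ) (λ r → (r ∈ R) × Σ (Fin p) (λ i → r i ≡ b)) →
    (∀ {r} → r ∈ R → ∀ i → c ≤ r i) → Σ (Fin p → ℕ) (λ r → (r ∈ R) × Σ (Fin p) (λ i → r i ≡ c)) →
    t ≤ c →
    (∀ i → 2 * (t + 1) * p * b ^ (t + 2) < ns i) →
    (𝓕 : List (Subset (total p ns))) → Unique 𝓕 →
    (∀ {F} → F ∈ 𝓕 → inH2 ns R F) → tIntersecting t 𝓕 →
    (∀ (𝓖 : List (Subset (total p ns))) → Unique 𝓖 →
    (∀ {G} → G ∈ 𝓖 → inH2 ns R G) → tIntersecting t 𝓖 → length 𝓖 ≤ length 𝓕) →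
    trivial t 𝓕
theorem1p4 p t 1≤p 1≤t ns _ R _ _ b c r≤b (r₀ , r₀∈R , i₀ , r₀i₀≡b) c≤r _ t≤c large
           𝓕 𝓕-unique 𝓕⊆H2 intersecting maximal =
  -- Members have at most `p * b` points, so `K` is `p * b`. With `N` equal to `suc t * (K * b)`,
  -- the lower bound `suc N` on the block sizes satisfies the strict smallness condition by
  -- `≤-refl`.
  maximum-trivial t (p * b) b (suc N) 𝓗 𝓕 𝓗-unique 𝓕-unique
    (λ F∈ → ∈-filter⁺ (inH2? ns R) (∈-subsets _) (𝓕⊆H2 F∈)) intersecting (*-mono-≤ 1≤p 1≤b)
    (λ {F} F∈ → ∣F∣≤p*b ns F (block-bound F (𝓕⊆H2 F∈))) extension star≤ ≤-refl t≤total
  where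
  open ≤-Reasoning
  n = total p ns
  𝓗 = filter (inH2? ns R) (subsets n)
  N = suc t * (p * b * b)
  𝓗-unique : Unique 𝓗
  𝓗-unique = Unique.filter⁺ (inH2? ns R) (subsets-unique n)
  𝓗⊆H2 : ∀ {H} → H ∈ 𝓗 → inH2 ns R H
  𝓗⊆H2 H∈ = proj₂ (∈-filter⁻ (inH2? ns R) {xs = subsets n} H∈)
  t≤b : t ≤ b
  t≤b = ≤-trans t≤c (≤-trans (c≤r r₀∈R i₀) (≤-reflexive r₀i₀≡b))
  1≤b : 1 ≤ b
  1≤b = ≤-trans 1≤t t≤b
  block-bound : ∀ F → inH2 ns R F → ∀ i → ∣ F ∩ block ns i ∣ ≤ b
  block-bound F (r , r∈R , profile) i = ≤-trans (≤-reflexive (profile i)) (r≤b r∈R i)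
  -- The assumed bound on `ns i` is `N` times `2 * b ^ t`, a factor that is at least 1 since `b` is
  -- positive.
  N<ns : ∀ i → suc N ≤ ns i
  N<ns i = ≤-trans (s≤s (begin
    suc t * (p * b * b)                    ≤⟨ m≤m*n _ (2 * b ^ t) {{>-nonZero 0<2b^t}} ⟩
    suc t * (p * b * b) * (2 * b ^ t)      ≡⟨ regroup t p b (b ^ t) ⟩
    2 * (t + 1) * p * (b ^ t * (b * (b * 1))) ≡⟨ cong (2 * (t + 1) * p *_) (^-distribˡ-+-* b t 2) ⟨
    2 * (t + 1) * p * b ^ (t + 2)          ∎)) (large i)
    where
    0<2b^t : 0 < 2 * b ^ t
    0<2b^t = *-mono-≤ {1} {2} (s≤s z≤n) (m^n>0 b {{>-nonZero 1≤b}} t)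
    regroup : ∀ t p b c → suc t * (p * b * b) * (2 * c) ≡ 2 * (t + 1) * p * (c * (b * (b * 1)))
    regroup = solve-∀
  t≤total : t ≤ n
  t≤total = begin
    t                       ≤⟨ t≤b ⟩
    b                       ≤⟨ m≤n*m b (suc t * p) {{>-nonZero (*-mono-≤ {1} {suc t} (s≤s z≤n) 1≤p)}} ⟩
    suc t * p * b           ≤⟨ m≤m*n _ b {{>-nonZero 1≤b}} ⟩
    suc t * p * b * b       ≡⟨ regroup t p b ⟩
    N                       ≤⟨ <⇒≤ (N<ns i₀) ⟩
    ns i₀                   ≤⟨ m≤n+m _ (lower ns i₀) ⟩
    lower ns i₀ + ns i₀     ≤⟨ lower+≤total ns i₀ ⟩
    n                       ∎
    where
    regroup : ∀ t p b → suc t * p * b * b ≡ suc t * (p * b * b)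
    regroup = solve-∀
  -- Let `Y` be the block of `x`. Swaps inside it keep `𝓗` closed, each member meets it in at most
  -- `b` points, and it has at least `suc N` points.
  extension : ∀ {S x} → x ∈ₛ S → count (S ⊆?_) 𝓗 * suc N ≤ b * count (S - x ⊆?_) 𝓗
  extension {S} {x} x∈S with i , x∈i ← inBlock-exists ns (toℕ x) (toℕ<n x) = ≤-trans
    (*-monoʳ-≤ (count (S ⊆?_) 𝓗) (≤-trans (N<ns i) (≤-reflexive (sym (∣block∣ ns i)))))
    (degree-extension 𝓗 𝓗-unique (block ns i) x∈S
      (λ {_} {H} y∈i H∈ → ∈-filter⁺ (inH2? ns R) (∈-subsets _) (swap-inH2 ns i H (∈-block⁺ ns i x∈i) y∈i (𝓗⊆H2 H∈)))
      (λ {H} H∈ → block-bound H (𝓗⊆H2 H∈) i))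
  -- Any two members containing `S` have `S` in common, so they form a `t`-intersecting family to
  -- which the maximality of `𝓕` applies.
  star≤ : ∀ {S} → t ≤ ∣ S ∣ → count (S ⊆?_) 𝓗 ≤ length 𝓕
  star≤ {S} t≤S = maximal (filter (S ⊆?_) 𝓗) (Unique.filter⁺ (S ⊆?_) 𝓗-unique)
    (λ H∈ → 𝓗⊆H2 (proj₁ (∈-filter⁻ (S ⊆?_) {xs = 𝓗} H∈)))
    (λ A∈ B∈ → ≤-trans t≤S (p⊆q⇒∣p∣≤∣q∣ λ z∈S → x∈p∩q⁺
      (proj₂ (∈-filter⁻ (S ⊆?_) {xs = 𝓗} A∈) z∈S , proj₂ (∈-filter⁻ (S ⊆?_) {xs = 𝓗} B∈) z∈S)))
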